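{- Let $\mathcal{G}$ be a dipath space, let $A,B\subseteq V(\mathcal{G})$ and let $k$ be a natural number. Then either there exists a set $X\subseteq V(\mathcal{G})$ with $|X|<k$ meeting every $A$–$B$-path in $\mathcal{G}$, or there exists a set of $k$ pairwise disjoint $A$–$B$-paths in $\mathcal{G}$.
   Context: A subset $Y$ of a linearly ordered set $X$ is called complete (in $X$) if every nonempty $Z \subseteq Y$ has a supremum and an infimum in $X$ and both lie in $Y$. A path is a linearly ordered set $(P,\le_P)$ that is complete in itself. Distinct paths may share elements; intersections and unions of paths refer to their underlying sets; paths are disjoint if their underlying sets are disjoint. A set of paths is compatible if for any two paths $P,Q$ in it, $P\cap Q$ is complete in $P$ (with the order of $P$). For $x \le y$ in a path $P$, the segment of $P$ from $x$ to $y$ is the interval $[x,y]$ of $P$ with the induced order. A path $P$ connects to a path $Q$ if $P \cap Q=\{x\}$ where $x=\max P=\min Q$; in this case the concatenation of $P$ and $Q$ is $P\cup Q$ with the order extending both orders in which every element of $P$ precedes every element of $Q$. A dipath space is a compatible set of paths closed under segments and under concatenations (whenever $P,Q$ are members and $P$ connects to $Q$, their concatenation is a member). $V(\mathcal{G})$ is the union of the underlying sets of the paths of $\mathcal{G}$. An $A$–$B$-path in $\mathcal{G}$ is a path $R\in\mathcal{G}$ with $R\cap A=\{\min R\}$ and $R\cap B=\{\max R\}$. A set meets a path if it intersects its underlying set. -}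

module Defs where

open import Level using (Level; suc; _⊔_)
open import Data.Nat.Base using (ℕ)
open import Data.Fin.Base using (Fin)
open import Data.Product.Base using (Σ; ∃; _×_; _,_; proj₁; proj₂)
open import Data.Sum.Base using (_⊎_; inj₁; inj₂)
open import Function.Base using (_on_)
open import Function.Bundles using (_⇔_)
open import Function.Definitions using (Injective)
open import Relation.Binary.Core using (Rel)
open import Relation.Binary.Definitions using (_Respects_)
open import Relation.Binary.Structures using (IsTotalOrder)
open import Relation.Binary.PropositionalEquality using (_≡_; refl; sym; trans; subst; isEquivalence)
import Relation.Binary.Construct.On as On
open import Relation.Nullary.Negation.Core using (¬_)
open import Relation.Unary using (Pred; _∈_; _⊆_; _∩_; _∪_; _≐_; _≬_; _⊥_; ｛_｝; Satisfiable)

private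
  variable
    a ℓ r : Level

-- A set whose elements are drawn from U, with a linear order on it.  Only the
-- restriction of _≤_ to the carrier matters; see _≈_ below.
record LinOrd {ℓ : Level} (U : Set ℓ) : Set (suc ℓ) where
  field
    Carrier      : Pred U ℓ
    _≤_          : Rel U ℓ
    isTotalOrder : IsTotalOrder {A = ∃ Carrier} (_≡_ on proj₁) (_≤_ on proj₁)

open LinOrd public using (Carrier)

infix 4 _≤[_]_

_≤[_]_ : {U : Set ℓ} → U → LinOrd U → U → Set ℓ
x ≤[ P ] y = LinOrd._≤_ P x y

module _ {U : Set ℓ} where

  infix 4 _≈_

  -- Equality of ordered sets: same elements, same order on them.
  _≈_ : Rel (LinOrd U) ℓ
  P ≈ Q = Carrier P ≐ Carrier Q
        × (∀ {x y} → x ∈ Carrier P → y ∈ Carrier P → (x ≤[ P ] y) ⇔ (x ≤[ Q ] y))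

  IsMin : LinOrd U → U → Set ℓ
  IsMin P x = x ∈ Carrier P × (∀ {y} → y ∈ Carrier P → x ≤[ P ] y)

  IsMax : LinOrd U → U → Set ℓ
  IsMax P x = x ∈ Carrier P × (∀ {y} → y ∈ Carrier P → y ≤[ P ] x)

  IsUpperBound : LinOrd U → Pred U ℓ → U → Set ℓ
  IsUpperBound X Z u = u ∈ Carrier X × (∀ {z} → z ∈ Z → z ≤[ X ] u)

  IsLowerBound : LinOrd U → Pred U ℓ → U → Set ℓ
  IsLowerBound X Z u = u ∈ Carrier X × (∀ {z} → z ∈ Z → u ≤[ X ] z)

  IsSupremum : LinOrd U → Pred U ℓ → U → Set ℓ
  IsSupremum X Z s = IsUpperBound X Z s × (∀ {u} → IsUpperBound X Z u → s ≤[ X ] u)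

  IsInfimum : LinOrd U → Pred U ℓ → U → Set ℓ
  IsInfimum X Z i = IsLowerBound X Z i × (∀ {u} → IsLowerBound X Z u → u ≤[ X ] i)

  -- Meant for Y ⊆ Carrier X.
  IsCompleteIn : LinOrd U → Pred U ℓ → Set (suc ℓ)
  IsCompleteIn X Y = (Z : Pred U ℓ) → Z ⊆ Y → Satisfiable Z →
      (∃ λ s → IsSupremum X Z s × s ∈ Y)
    × (∃ λ i → IsInfimum X Z i × i ∈ Y)

  IsPath : LinOrd U → Set (suc ℓ)
  IsPath P = IsCompleteIn P (Carrier P)

  segment : LinOrd U → U → U → LinOrd U
  segment P x y = record
    { Carrier      = λ z → z ∈ Carrier P × x ≤[ P ] z × z ≤[ P ] y
    ; _≤_          = LinOrd._≤_ P
    ; isTotalOrder = On.isTotalOrder (λ { (z , z∈P , _) → z , z∈P }) (LinOrd.isTotalOrder P)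
    }

  ConnectsAt : LinOrd U → LinOrd U → U → Set ℓ
  ConnectsAt P Q x = (Carrier P ∩ Carrier Q) ≐ ｛ x ｝ × IsMax P x × IsMin Q x

  Connects : LinOrd U → LinOrd U → Set ℓ
  Connects P Q = ∃ (ConnectsAt P Q)

  data Concat≤ (P Q : LinOrd U) (x y : U) : Set ℓ where
    left  : x ∈ Carrier P → y ∈ Carrier P → x ≤[ P ] y → Concat≤ P Q x y
    right : x ∈ Carrier Q → y ∈ Carrier Q → x ≤[ Q ] y → Concat≤ P Q x y
    cross : x ∈ Carrier P → y ∈ Carrier Q → Concat≤ P Q x y

  concatenation : (P Q : LinOrd U) → Connects P Q → LinOrd U
  concatenation P Q (m , (P∩Q⊆m , _) , (m∈P , max) , (m∈Q , min)) = record
    { Carrier      = Carrier P ∪ Carrier Q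
    ; _≤_          = Concat≤ P Q
    ; isTotalOrder = record
      { isPartialOrder = record
        { isPreorder = record
          { isEquivalence = On.isEquivalence proj₁ isEquivalence
          ; reflexive     = λ {p} {q} → reflexive p q
          ; trans         = transitive
          }
        ; antisym = antisymmetric
        }
      ; total = total
      }
    }
    where
    module P = IsTotalOrder (LinOrd.isTotalOrder P)
    module Q = IsTotalOrder (LinOrd.isTotalOrder Q)

    common : ∀ {x} → x ∈ Carrier P → x ∈ Carrier Q → m ≡ x
    common x∈P x∈Q = P∩Q⊆m (x∈P , x∈Q)

    above : ∀ {x y} → m ≡ x → y ∈ Carrier P → x ≤[ P ] y → m ≡ y
    above refl y∈P m≤y = P.antisym {_ , m∈P} {_ , y∈P} m≤y (max y∈P)

    below : ∀ {x y} → m ≡ y → x ∈ Carrier Q → x ≤[ Q ] y → m ≡ x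
    below refl x∈Q x≤m = Q.antisym {_ , m∈Q} {_ , x∈Q} (min x∈Q) x≤m

    reflexive : (p q : ∃ (Carrier P ∪ Carrier Q)) → proj₁ p ≡ proj₁ q → Concat≤ P Q (proj₁ p) (proj₁ q)
    reflexive (x , inj₁ x∈P) (.x , _) refl = left x∈P x∈P (P.refl {_ , x∈P})
    reflexive (x , inj₂ x∈Q) (.x , _) refl = right x∈Q x∈Q (Q.refl {_ , x∈Q})

    transitive : ∀ {x y z} → Concat≤ P Q x y → Concat≤ P Q y z → Concat≤ P Q x z
    transitive (left x∈P y∈P x≤y) (left _ z∈P y≤z) =
      left x∈P z∈P (P.trans {_ , x∈P} {_ , y∈P} {_ , z∈P} x≤y y≤z)
    transitive (left x∈P _ _) (right _ z∈Q _) = cross x∈P z∈Q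
    transitive (left x∈P _ _) (cross _ z∈Q) = cross x∈P z∈Q
    transitive (right x∈Q y∈Q x≤y) (left y∈P z∈P y≤z) =
      cross (subst (Carrier P) (below (common y∈P y∈Q) x∈Q x≤y) m∈P)
            (subst (Carrier Q) (above (common y∈P y∈Q) z∈P y≤z) m∈Q)
    transitive (right x∈Q y∈Q x≤y) (right _ z∈Q y≤z) =
      right x∈Q z∈Q (Q.trans {_ , x∈Q} {_ , y∈Q} {_ , z∈Q} x≤y y≤z)
    transitive (right x∈Q y∈Q x≤y) (cross y∈P z∈Q) =
      cross (subst (Carrier P) (below (common y∈P y∈Q) x∈Q x≤y) m∈P) z∈Q
    transitive (cross x∈P y∈Q) (left y∈P z∈P y≤z) =
      cross x∈P (subst (Carrier Q) (above (common y∈P y∈Q) z∈P y≤z) m∈Q)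
    transitive (cross x∈P _) (right _ z∈Q _) = cross x∈P z∈Q
    transitive (cross x∈P _) (cross _ z∈Q) = cross x∈P z∈Q

    antisymmetric : ∀ {x y} → Concat≤ P Q x y → Concat≤ P Q y x → x ≡ y
    antisymmetric (left x∈P y∈P x≤y) (left _ _ y≤x) = P.antisym {_ , x∈P} {_ , y∈P} x≤y y≤x
    antisymmetric (left x∈P y∈P _) (right y∈Q x∈Q _) = trans (sym (common x∈P x∈Q)) (common y∈P y∈Q)
    antisymmetric (left x∈P y∈P x≤y) (cross _ x∈Q) =
      trans (sym (common x∈P x∈Q)) (above (common x∈P x∈Q) y∈P x≤y)
    antisymmetric (right x∈Q y∈Q _) (left y∈P x∈P _) = trans (sym (common x∈P x∈Q)) (common y∈P y∈Q)
    antisymmetric (right x∈Q y∈Q x≤y) (right _ _ y≤x) = Q.antisym {_ , x∈Q} {_ , y∈Q} x≤y y≤x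
    antisymmetric (right x∈Q y∈Q x≤y) (cross y∈P _) =
      trans (sym (below (common y∈P y∈Q) x∈Q x≤y)) (common y∈P y∈Q)
    antisymmetric (cross x∈P y∈Q) (left y∈P _ y≤x) =
      trans (sym (above (common y∈P y∈Q) x∈P y≤x)) (common y∈P y∈Q)
    antisymmetric (cross x∈P y∈Q) (right _ x∈Q y≤x) =
      trans (sym (common x∈P x∈Q)) (below (common x∈P x∈Q) y∈Q y≤x)
    antisymmetric (cross x∈P y∈Q) (cross y∈P x∈Q) = trans (sym (common x∈P x∈Q)) (common y∈P y∈Q)

    total : (p q : ∃ (Carrier P ∪ Carrier Q)) →
            Concat≤ P Q (proj₁ p) (proj₁ q) ⊎ Concat≤ P Q (proj₁ q) (proj₁ p)
    total (x , inj₁ x∈P) (y , inj₁ y∈P) with P.total (x , x∈P) (y , y∈P)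
    ... | inj₁ x≤y = inj₁ (left x∈P y∈P x≤y)
    ... | inj₂ y≤x = inj₂ (left y∈P x∈P y≤x)
    total (x , inj₁ x∈P) (y , inj₂ y∈Q) = inj₁ (cross x∈P y∈Q)
    total (x , inj₂ x∈Q) (y , inj₁ y∈P) = inj₂ (cross y∈P x∈Q)
    total (x , inj₂ x∈Q) (y , inj₂ y∈Q) with Q.total (x , x∈Q) (y , y∈Q)
    ... | inj₁ x≤y = inj₁ (right x∈Q y∈Q x≤y)
    ... | inj₂ y≤x = inj₂ (right y∈Q x∈Q y≤x)

-- The field respects says that 𝒢 is a set of ordered sets, these being
-- identified along _≈_.
record IsDipathSpace {U : Set ℓ} (𝒢 : Pred (LinOrd U) (suc ℓ)) : Set (suc ℓ) where
  field
    respects       : 𝒢 Respects _≈_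
    paths          : ∀ {P} → P ∈ 𝒢 → IsPath P
    compatible     : ∀ {P Q} → P ∈ 𝒢 → Q ∈ 𝒢 → IsCompleteIn P (Carrier P ∩ Carrier Q)
    segments       : ∀ {P x y} → P ∈ 𝒢 → x ∈ Carrier P → y ∈ Carrier P → x ≤[ P ] y →
                     segment P x y ∈ 𝒢
    concatenations : ∀ {P Q} → P ∈ 𝒢 → Q ∈ 𝒢 → (c : Connects P Q) →
                     concatenation P Q c ∈ 𝒢

module _ {U : Set ℓ} where

  V : Pred (LinOrd U) (suc ℓ) → Pred U (suc ℓ)
  V 𝒢 x = ∃ λ P → P ∈ 𝒢 × x ∈ Carrier P

  IsABPath : Pred (LinOrd U) (suc ℓ) → (A B : Pred U ℓ) → Pred (LinOrd U) (suc ℓ)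
  IsABPath 𝒢 A B R = R ∈ 𝒢
    × (∃ λ x → IsMin R x × (Carrier R ∩ A) ≐ ｛ x ｝)
    × (∃ λ y → IsMax R y × (Carrier R ∩ B) ≐ ｛ y ｝)

  Meets : Pred U ℓ → LinOrd U → Set ℓ
  Meets X P = X ≬ Carrier P

  Disjoint : LinOrd U → LinOrd U → Set ℓ
  Disjoint P Q = Carrier P ⊥ Carrier Q

  PairwiseDisjoint : Pred (LinOrd U) ℓ → Set (suc ℓ)
  PairwiseDisjoint 𝒫 = ∀ {P Q} → P ∈ 𝒫 → Q ∈ 𝒫 → ¬ (P ≈ Q) → Disjoint P Q

-- X, as a subset of S with equality _~_, has exactly n elements.
HasCardinality : {S : Set a} → Rel S r → Pred S r → ℕ → Set (a ⊔ r)
HasCardinality {S = S} _~_ X n =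
  Σ (Fin n → S) λ f → Injective _≡_ _~_ f × X ≐ (λ x → ∃ λ i → f i ~ x)

{-# OPTIONS --safe #-}

-- Let P₁, …, Pₙ be disjoint A–B-paths; we find n + 1 such paths or n points
-- separating A from B.  As in the proof of Menger's theorem by enlarging the
-- target, consider pairs of points eᵢ ∈ Pᵢ and a set B′ with B′ ∩ Pᵢ = [eᵢ, max Pᵢ]
-- such that n + 1 disjoint A–B′-paths, n of them ending in e₁, …, eₙ, can always be
-- converted into n + 1 disjoint A–B-paths.  If an A–B′-path R, ending in b, leaves
-- the union of the initial segments Pᵢeᵢ for the last time in x ∈ Pⱼ, then
-- adding [x, eⱼ] ⊆ Pⱼ and [x, b] ⊆ R to B′ and moving eⱼ back to x gives another
-- such pair.  In a finite graph this is iterated until some R avoids all Pᵢeᵢ.  Here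
-- let xᵢ ∈ Pᵢ be the infimum of all eᵢ occurring in such pairs.  If an A–B-path R
-- avoids all xᵢ, take its first point z in some [xᵢ, max Pᵢ]; a pair with eᵢ < z has
-- z ∈ B′, and a single further step with an initial segment of R would move some eⱼ
-- below xⱼ.  So this initial segment avoids all Pᵢeᵢ.
module Submission where

open import Defs
open import Level using (Level; suc; Lift; lift; lower)
open import Axiom.ExcludedMiddle using (ExcludedMiddle)
open import Data.Nat.Base using (ℕ; _<_)
open import Data.Nat.Properties using (n<1+n; m<n⇒m<1+n)
open import Data.Fin.Base using (Fin)
open import Data.Fin.Properties using (_≟_)
open import Data.Product.Base using (Σ; ∃; _×_; _,_; proj₁; proj₂)
open import Data.Sum.Base using (_⊎_; inj₁; inj₂)
open import Data.Vec.Functional using (updateAt)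
open import Data.Vec.Functional.Properties using (updateAt-updates; updateAt-minimal)
open import Function.Base using (_∘_; const; flip)
open import Function.Bundles using (Equivalence)
open import Function.Properties.Equivalence using () renaming (sym to ⇔-sym; trans to ⇔-trans)
open import Relation.Binary.PropositionalEquality using (_≡_; _≢_; refl; sym; subst)
open import Relation.Binary.Structures using (IsTotalOrder)
import Relation.Binary.Construct.Flip.EqAndOrd as Flip
open import Relation.Nullary.Decidable using (Dec; yes; no; True; toWitness; fromWitness; map′)
open import Relation.Nullary.Negation using (¬_; contradiction)
open import Relation.Unary using (Pred; _∈_; _∉_; _⊆_; _∩_; _∪_; ⋃; Satisfiable)

private
  variable
    ℓ : Level

-- Excluded middle one level down, and one-place changes of finite families.

lowerEM : ExcludedMiddle (suc ℓ) → ExcludedMiddle ℓ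
lowerEM {ℓ} em {P} = map′ lower lift (em {Lift (suc ℓ) P})

-- Checks a property of a family with one member replaced; used whenever `e j` or `Q j` is
-- exchanged.
updateAt-elim : ∀ {a p} {S : Set a} {n} (Φ : Fin n → S → Set p) {f : Fin n → S} {j x} →
  Φ j x → (∀ i → i ≢ j → Φ i (f i)) → ∀ i → Φ i (updateAt f j (const x) i)
updateAt-elim Φ {f} {j} Φj Φi i with i ≟ j
... | yes refl = subst (Φ j) (sym (updateAt-updates j f)) Φj
... | no  i≢j  = subst (Φ i) (sym (updateAt-minimal i j f i≢j)) (Φi i i≢j)

-- Linear orders, first points in a given set, and equality of ordered sets.

module _ {U : Set ℓ} where

  module _ (P : LinOrd U) where

    private
      module P = IsTotalOrder (LinOrd.isTotalOrder P)

    ≤-refl : ∀ {x} → x ∈ Carrier P → x ≤[ P ] x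
    ≤-refl x∈P = P.refl {_ , x∈P}

    ≤-trans : ∀ {x y z} → x ∈ Carrier P → y ∈ Carrier P → z ∈ Carrier P →
              x ≤[ P ] y → y ≤[ P ] z → x ≤[ P ] z
    ≤-trans x∈P y∈P z∈P = P.trans {_ , x∈P} {_ , y∈P} {_ , z∈P}

    ≤-antisym : ∀ {x y} → x ∈ Carrier P → y ∈ Carrier P → x ≤[ P ] y → y ≤[ P ] x → x ≡ y
    ≤-antisym x∈P y∈P = P.antisym {_ , x∈P} {_ , y∈P}

    ≤-total : ∀ {x y} → x ∈ Carrier P → y ∈ Carrier P → x ≤[ P ] y ⊎ y ≤[ P ] x
    ≤-total x∈P y∈P = P.total (_ , x∈P) (_ , y∈P)

  -- Reversing the order lets the results on first points serve for last points as well.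
  dual : LinOrd U → LinOrd U
  dual P = record
    { Carrier      = Carrier P
    ; _≤_          = flip (LinOrd._≤_ P)
    ; isTotalOrder = Flip.isTotalOrder (LinOrd.isTotalOrder P)
    }

  IsLeast : LinOrd U → Pred U ℓ → U → Set ℓ
  IsLeast P X m = m ∈ Carrier P × m ∈ X × (∀ {y} → y ∈ Carrier P → y ∈ X → m ≤[ P ] y)

  -- Conditional on `P` meeting `X`, so that the property passes to finite unions some of whose
  -- members `P` may miss.
  HasLeast : LinOrd U → Pred U ℓ → Set ℓ
  HasLeast P X = Satisfiable (Carrier P ∩ X) → ∃ (IsLeast P X)

  HasLeast-∪ : ExcludedMiddle ℓ → ∀ {P X Y} → HasLeast P X → HasLeast P Y → HasLeast P (X ∪ Y)
  HasLeast-∪ em {P} {X} {Y} leastX leastY (w , w∈P , w∈X∪Y)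
    with em {Satisfiable (Carrier P ∩ X)} | em {Satisfiable (Carrier P ∩ Y)}
  ... | no X≡∅ | no Y≡∅ = contradiction w∈X∪Y λ where
    (inj₁ w∈X) → X≡∅ (w , w∈P , w∈X)
    (inj₂ w∈Y) → Y≡∅ (w , w∈P , w∈Y)
  ... | yes X≢∅ | no Y≡∅ with leastX X≢∅
  ...   | m , m∈P , m∈X , m≤ = m , m∈P , inj₁ m∈X , λ where
    y∈P (inj₁ y∈X) → m≤ y∈P y∈X
    y∈P (inj₂ y∈Y) → contradiction (_ , y∈P , y∈Y) Y≡∅
  HasLeast-∪ em {P} leastX leastY _ | no X≡∅ | yes Y≢∅ with leastY Y≢∅
  ...   | m , m∈P , m∈Y , m≤ = m , m∈P , inj₂ m∈Y , λ where
    y∈P (inj₁ y∈X) → contradiction (_ , y∈P , y∈X) X≡∅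
    y∈P (inj₂ y∈Y) → m≤ y∈P y∈Y
  HasLeast-∪ em {P} leastX leastY _ | yes X≢∅ | yes Y≢∅ with leastX X≢∅ | leastY Y≢∅
  ...   | m , m∈P , m∈X , m≤ | l , l∈P , l∈Y , l≤ with ≤-total P m∈P l∈P
  ...     | inj₁ m≤l = m , m∈P , inj₁ m∈X , λ where
    y∈P (inj₁ y∈X) → m≤ y∈P y∈X
    y∈P (inj₂ y∈Y) → ≤-trans P m∈P l∈P y∈P m≤l (l≤ y∈P y∈Y)
  ...     | inj₂ l≤m = l , l∈P , inj₂ l∈Y , λ where
    y∈P (inj₁ y∈X) → ≤-trans P l∈P m∈P y∈P l≤m (m≤ y∈P y∈X)
    y∈P (inj₂ y∈Y) → l≤ y∈P y∈Y

  HasLeast-⋃ : ExcludedMiddle ℓ → ∀ {P n} {X : Fin n → Pred U ℓ} →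
               (∀ i → HasLeast P (X i)) → HasLeast P (⋃ (Fin n) X)
  HasLeast-⋃ em {n = ℕ.zero} least (_ , _ , () , _)
  HasLeast-⋃ em {P} {ℕ.suc n} {X} least (w , w∈P , i , w∈Xi) =
    let m , m∈P , m∈ , m≤ = HasLeast-∪ em {P} (least Fin.zero) (HasLeast-⋃ em {P} (least ∘ Fin.suc))
                              (w , w∈P , split (i , w∈Xi))
    in m , m∈P , join m∈ , λ y∈P y∈ → m≤ y∈P (split y∈)
    where
    split : ⋃ (Fin (ℕ.suc n)) X ⊆ X Fin.zero ∪ ⋃ (Fin n) (X ∘ Fin.suc)
    split (Fin.zero  , y∈) = inj₁ y∈
    split (Fin.suc i , y∈) = inj₂ (i , y∈)

    join : X Fin.zero ∪ ⋃ (Fin n) (X ∘ Fin.suc) ⊆ ⋃ (Fin (ℕ.suc n)) X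
    join (inj₁ y∈)       = Fin.zero , y∈
    join (inj₂ (i , y∈)) = Fin.suc i , y∈

  ≈-sym : ∀ {P Q : LinOrd U} → P ≈ Q → Q ≈ P
  ≈-sym ((P⊆Q , Q⊆P) , ≤⇔) = (Q⊆P , P⊆Q) , λ x∈Q y∈Q → ⇔-sym (≤⇔ (Q⊆P x∈Q) (Q⊆P y∈Q))

  ≈-trans : ∀ {P Q R : LinOrd U} → P ≈ Q → Q ≈ R → P ≈ R
  ≈-trans ((P⊆Q , Q⊆P) , PQ) ((Q⊆R , R⊆Q) , QR) =
    (Q⊆R ∘ P⊆Q , Q⊆P ∘ R⊆Q) , λ x∈P y∈P → ⇔-trans (PQ x∈P y∈P) (QR (P⊆Q x∈P) (P⊆Q y∈P))

-- A-B-paths: first points, cutting and concatenating.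

module DipathSpace (em : ExcludedMiddle (suc ℓ)) {U : Set ℓ} {𝒢 : Pred (LinOrd U) (suc ℓ)}
                   (𝒢-space : IsDipathSpace 𝒢) (A : Pred U ℓ) where

  open IsDipathSpace 𝒢-space

  em₀ : ExcludedMiddle ℓ
  em₀ = lowerEM em

  -- Compatibility makes the intersection complete in `R`, so its infimum belongs to it.
  first-on : ∀ {R S} → R ∈ 𝒢 → S ∈ 𝒢 → HasLeast R (Carrier S)
  first-on R∈𝒢 S∈𝒢 meet with proj₂ (compatible R∈𝒢 S∈𝒢 _ (λ y∈ → y∈) meet)
  ... | m , ((m∈R , m≤) , _) , (_ , m∈S) = m , m∈R , m∈S , λ y∈R y∈S → m≤ (y∈R , y∈S)

  last-on : ∀ {R S} → R ∈ 𝒢 → S ∈ 𝒢 → HasLeast (dual R) (Carrier S)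
  last-on R∈𝒢 S∈𝒢 meet with proj₁ (compatible R∈𝒢 S∈𝒢 _ (λ y∈ → y∈) meet)
  ... | m , ((m∈R , ≤m) , _) , (_ , m∈S) = m , m∈R , m∈S , λ y∈R y∈S → ≤m (y∈R , y∈S)

  IsABPath-respects-≈ : ∀ {B P Q} → P ≈ Q → P ∈ IsABPath 𝒢 A B → Q ∈ IsABPath 𝒢 A B
  IsABPath-respects-≈ P≈Q@((P⊆Q , Q⊆P) , ≤⇔)
    (P∈𝒢 , (x , (x∈P , x≤) , PA⊆ , ⊆PA) , (y , (y∈P , ≤y) , PB⊆ , ⊆PB)) =
      respects P≈Q P∈𝒢
    , (x , (P⊆Q x∈P , λ z∈Q → Equivalence.to (≤⇔ x∈P (Q⊆P z∈Q)) (x≤ (Q⊆P z∈Q)))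
         , (λ (z∈Q , z∈A) → PA⊆ (Q⊆P z∈Q , z∈A))
         , (λ x≡z → P⊆Q (proj₁ (⊆PA x≡z)) , proj₂ (⊆PA x≡z)))
    , (y , (P⊆Q y∈P , λ z∈Q → Equivalence.to (≤⇔ (Q⊆P z∈Q) y∈P) (≤y (Q⊆P z∈Q)))
         , (λ (z∈Q , z∈B) → PB⊆ (Q⊆P z∈Q , z∈B))
         , (λ y≡z → P⊆Q (proj₁ (⊆PB y≡z)) , proj₂ (⊆PB y≡z)))

  -- The end `t` is a parameter, so that a family of paths can be required to end in prescribed
  -- points.
  record ABPathTo (B : Pred U ℓ) (R : LinOrd U) (t : U) : Set (suc ℓ) where
    field
      ∈𝒢         : R ∈ 𝒢
      start      : U
      start-min  : IsMin R start
      start∈A    : start ∈ A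
      start-only : ∀ {y} → y ∈ Carrier R → y ∈ A → start ≡ y
      end-max    : IsMax R t
      end∈B      : t ∈ B
      end-only   : ∀ {y} → y ∈ Carrier R → y ∈ B → t ≡ y

    start∈ : start ∈ Carrier R
    start∈ = proj₁ start-min

    end∈ : t ∈ Carrier R
    end∈ = proj₁ end-max

  fromIsABPath : ∀ {B R} → R ∈ IsABPath 𝒢 A B → ∃ (ABPathTo B R)
  fromIsABPath (R∈𝒢 , (x , min , RA⊆ , ⊆RA) , (y , max , RB⊆ , ⊆RB)) = y , record
    { ∈𝒢         = R∈𝒢
    ; start      = x
    ; start-min  = min
    ; start∈A    = proj₂ (⊆RA refl)
    ; start-only = λ z∈R z∈A → RA⊆ (z∈R , z∈A)
    ; end-max    = max
    ; end∈B      = proj₂ (⊆RB refl)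
    ; end-only   = λ z∈R z∈B → RB⊆ (z∈R , z∈B)
    }

  toIsABPath : ∀ {B R t} → ABPathTo B R t → R ∈ IsABPath 𝒢 A B
  toIsABPath {t = t} R =
      R.∈𝒢
    , (R.start , R.start-min , (λ (z∈R , z∈A) → R.start-only z∈R z∈A) , λ { refl → R.start∈ , R.start∈A })
    , (t , R.end-max , (λ (z∈R , z∈B) → R.end-only z∈R z∈B) , λ { refl → R.end∈ , R.end∈B })
    where
    module R = ABPathTo R

  end-least : ∀ {B R t} → ABPathTo B R t → IsLeast R B t
  end-least {R = R} {t} Rp = R.end∈ , R.end∈B , λ y∈R y∈B →
    subst (λ z → t ≤[ R ] z) (R.end-only y∈R y∈B) (≤-refl R R.end∈)
    where
    module R = ABPathTo Rp

  shrinkTarget : ∀ {B B′ R t} → B ⊆ B′ → t ∈ B → ABPathTo B′ R t → ABPathTo B R t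
  shrinkTarget B⊆B′ t∈B R = record
    { ∈𝒢         = R.∈𝒢
    ; start      = R.start
    ; start-min  = R.start-min
    ; start∈A    = R.start∈A
    ; start-only = R.start-only
    ; end-max    = R.end-max
    ; end∈B      = t∈B
    ; end-only   = λ y∈R y∈B → R.end-only y∈R (B⊆B′ y∈B)
    }
    where
    module R = ABPathTo R

  initialSegment : ∀ {B B′ R t b} (r : ABPathTo B R t) → IsLeast R B′ b →
                   ABPathTo B′ (segment R (ABPathTo.start r) b) b
  initialSegment {R = R} r (b∈R , b∈B′ , b≤) = record
    { ∈𝒢         = segments r.∈𝒢 r.start∈ b∈R (start≤ b∈R)
    ; start      = r.start
    ; start-min  = (r.start∈ , ≤-refl R r.start∈ , start≤ b∈R) , λ (_ , start≤y , _) → start≤y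
    ; start∈A    = r.start∈A
    ; start-only = λ (y∈R , _) → r.start-only y∈R
    ; end-max    = (b∈R , start≤ b∈R , ≤-refl R b∈R) , λ (_ , _ , y≤b) → y≤b
    ; end∈B      = b∈B′
    ; end-only   = λ (y∈R , _ , y≤b) y∈B′ → ≤-antisym R b∈R y∈R (b≤ y∈R y∈B′) y≤b
    }
    where
    module r = ABPathTo r
    start≤ : ∀ {y} → y ∈ Carrier R → r.start ≤[ R ] y
    start≤ = proj₂ r.start-min

  -- `Q` meets `B′` only in `q`, and `T` lies in `B′` from `q` onwards; so the two meet only in `q`
  -- and can be concatenated. The last clause serves the later disjointness arguments.
  extend : ∀ {B B′ Q q T t} → B ⊆ B′ → ABPathTo B′ Q q → ABPathTo B T t → q ∈ Carrier T →
           (∀ {y} → y ∈ Carrier T → q ≤[ T ] y → y ∈ B′) →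
           Σ (LinOrd U) λ Z → ABPathTo B Z t ×
             (∀ {y} → y ∈ Carrier Z → y ∈ Carrier Q ⊎ (y ∈ Carrier T × q ≤[ T ] y))
  extend {B} {Q = Q} {q} {T} {t} B⊆B′ Qp Tp q∈T qT⊆B′ =
    concatenation Q (segment T q t) connects , path , λ where
      (inj₁ y∈Q)             → inj₁ y∈Q
      (inj₂ (y∈T , q≤y , _)) → inj₂ (y∈T , q≤y)
    where
    module Q = ABPathTo Qp
    module T = ABPathTo Tp

    q≤t : q ≤[ T ] t
    q≤t = proj₂ T.end-max q∈T

    q∈qT : q ∈ Carrier (segment T q t)
    q∈qT = q∈T , ≤-refl T q∈T , q≤t

    t∈qT : t ∈ Carrier (segment T q t)
    t∈qT = T.end∈ , q≤t , ≤-refl T T.end∈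

    connects : Connects Q (segment T q t)
    connects = q
      , ((λ (y∈Q , y∈T , q≤y , _) → Q.end-only y∈Q (qT⊆B′ y∈T q≤y)) , λ { refl → Q.end∈ , q∈qT })
      , Q.end-max
      , (q∈qT , λ (_ , q≤y , _) → q≤y)

    -- A point of A on the segment is the first point of T, hence equal to q.
    start-only : ∀ {y} → y ∈ Carrier Q ⊎ y ∈ Carrier (segment T q t) → y ∈ A → Q.start ≡ y
    start-only (inj₁ y∈Q) y∈A = Q.start-only y∈Q y∈A
    start-only (inj₂ (y∈T , q≤y , _)) y∈A with T.start-only y∈T y∈A
    ... | refl with ≤-antisym T q∈T y∈T q≤y (proj₂ T.start-min q∈T)
    ...   | refl = Q.start-only Q.end∈ y∈A

    end-only : ∀ {y} → y ∈ Carrier Q ⊎ y ∈ Carrier (segment T q t) → y ∈ B → t ≡ y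
    end-only (inj₂ (y∈T , _)) y∈B = T.end-only y∈T y∈B
    end-only (inj₁ y∈Q) y∈B with Q.end-only y∈Q (B⊆B′ y∈B)
    ... | refl = T.end-only q∈T y∈B

    path : ABPathTo B (concatenation Q (segment T q t) connects) t
    path = record
      { ∈𝒢         = concatenations Q.∈𝒢 (segments T.∈𝒢 q∈T T.end∈ q≤t) connects
      ; start      = Q.start
      ; start-min  = inj₁ Q.start∈ , λ where
          (inj₁ y∈Q)  → left Q.start∈ y∈Q (proj₂ Q.start-min y∈Q)
          (inj₂ y∈qT) → cross Q.start∈ y∈qT
      ; start∈A    = Q.start∈A
      ; start-only = start-only
      ; end-max    = inj₂ t∈qT , λ where
          (inj₁ y∈Q)                 → cross y∈Q t∈qT
          (inj₂ y∈qT@(_ , _ , y≤t)) → right y∈qT t∈qT y≤t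
      ; end∈B      = T.end∈B
      ; end-only   = end-only
      }

  -- Disjoint families of paths, and linkages.

  Disjointly : ∀ {n} → (Fin n → LinOrd U) → Set ℓ
  Disjointly Q = ∀ {i j} → i ≢ j → Disjoint (Q i) (Q j)

  DisjointABPaths : Pred U ℓ → ℕ → Set (suc ℓ)
  DisjointABPaths B n = Σ (Fin n → LinOrd U) λ Q → (∀ i → Q i ∈ IsABPath 𝒢 A B) × Disjointly Q

  -- These are the n + 1 paths that a step reroutes; only the end `t` of the additional path is
  -- free.
  record Linkage {n} (e : Fin n → U) (B : Pred U ℓ) : Set (suc ℓ) where
    field
      Q         : Fin n → LinOrd U
      Q-path    : ∀ i → ABPathTo B (Q i) (e i)
      disjoint  : Disjointly Q
      Q₀        : LinOrd U
      t         : U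
      Q₀-path   : ABPathTo B Q₀ t
      disjoint₀ : ∀ i → Disjoint Q₀ (Q i)

  fromLinkage : ∀ {n} {e : Fin n → U} {B} → Linkage e B → DisjointABPaths B (ℕ.suc n)
  fromLinkage {n} L = family , path , disj
    where
    open Linkage L
    family : Fin (ℕ.suc n) → LinOrd U
    family Fin.zero    = Q₀
    family (Fin.suc i) = Q i

    path : ∀ i → family i ∈ IsABPath 𝒢 A _
    path Fin.zero    = toIsABPath Q₀-path
    path (Fin.suc i) = toIsABPath (Q-path i)

    disj : Disjointly family
    disj {Fin.zero}  {Fin.zero}  0≢0 _ = 0≢0 refl
    disj {Fin.zero}  {Fin.suc j} _ meet = disjoint₀ j meet
    disj {Fin.suc i} {Fin.zero}  _ (y∈ , y∈′) = disjoint₀ i (y∈′ , y∈)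
    disj {Fin.suc i} {Fin.suc j} i≢j meet = disjoint (λ { refl → i≢j refl }) meet

  -- Stages: end points on the given paths together with an enlarged target.

  module Augmentation (B : Pred U ℓ) {n : ℕ} (P : Fin n → LinOrd U) (f : Fin n → U)
                      (P-path : ∀ i → ABPathTo B (P i) (f i)) (P-disjoint : Disjointly P) where

    private
      module P i = ABPathTo (P-path i)

    same : ∀ {i j y} → y ∈ Carrier (P i) → y ∈ Carrier (P j) → i ≡ j
    same {i} {j} y∈Pi y∈Pj with i ≟ j
    ... | yes i≡j = i≡j
    ... | no  i≢j = contradiction (y∈Pi , y∈Pj) (P-disjoint i≢j)

    -- `above` and `only` say that `B′` cuts `P i` in its final segment from `e i`. `first` stands
    -- in for finiteness, as a path need not have a first point in an arbitrary set. `augment`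
    -- carries the composite of all reroutings so far, so that a further step need not know how `B′`
    -- arose.
    record Stage (e : Fin n → U) (B′ : Pred U ℓ) : Set (suc ℓ) where
      field
        e∈P     : ∀ i → e i ∈ Carrier (P i)
        above   : ∀ i {y} → y ∈ Carrier (P i) → e i ≤[ P i ] y → y ∈ B′
        only    : ∀ i {y} → y ∈ Carrier (P i) → y ∈ B′ → e i ≤[ P i ] y
        first   : ∀ {R} → R ∈ IsABPath 𝒢 A B → HasLeast R B′
        augment : Linkage e B′ → DisjointABPaths B (ℕ.suc n)

      head : Fin n → LinOrd U
      head i = segment (P i) (P.start i) (e i)

      head-path : ∀ i → ABPathTo B′ (head i) (e i)
      head-path i = initialSegment (P-path i)
        (e∈P i , above i (e∈P i) (≤-refl (P i) (e∈P i)) , only i)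

      ∈head : ∀ {i y} → y ∈ Carrier (P i) → y ≤[ P i ] e i → y ∈ Carrier (head i)
      ∈head {i} y∈P y≤e = y∈P , proj₂ (P.start-min i) y∈P , y≤e

    initialStage : Stage f B
    initialStage = record
      { e∈P     = P.end∈
      ; above   = λ i y∈P f≤y → subst B
          (≤-antisym (P i) (P.end∈ i) y∈P f≤y (proj₂ (P.end-max i) y∈P)) (P.end∈B i)
      ; only    = λ i → proj₂ (proj₂ (end-least (P-path i)))
      ; first   = λ R-AB _ → _ , end-least (proj₂ (fromIsABPath R-AB))
      ; augment = fromLinkage
      }

    -- One step: moving `e j` back to `x`.

    module Step {e : Fin n → U} {B′ : Pred U ℓ} (s : Stage e B′)
                {R : LinOrd U} {b : U} (R-path : ABPathTo B′ R b) {j : Fin n} {x : U}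
                (x∈R : x ∈ Carrier R) (x∈Pj : x ∈ Carrier (P j)) (x≤e : x ≤[ P j ] e j)
                (last : ∀ {i y} → y ∈ Carrier R → y ∈ Carrier (P i) → y ≤[ P i ] e i → y ≤[ R ] x)
                where

      open Stage s
      private
        module R = ABPathTo R-path
        module H = ABPathTo (head-path j)

      H : LinOrd U
      H = head j

      xH xR : LinOrd U
      xH = segment H x (e j)
      xR = segment R x b

      x∈H : x ∈ Carrier H
      x∈H = ∈head x∈Pj x≤e

      -- A path that reaches one of the added pieces can be completed along it, to `e j` on `xH` and
      -- to `b` on `xR`.
      B″ : Pred U ℓ
      B″ = B′ ∪ (Carrier xH ∪ Carrier xR)

      e′ : Fin n → U
      e′ = updateAt e j (const x)

      ∈xH : ∀ {y} → y ∈ Carrier H → x ≤[ P j ] y → y ∈ Carrier xH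
      ∈xH y∈H x≤y = y∈H , x≤y , proj₂ H.end-max y∈H

      ∈xR : ∀ {y} → y ∈ Carrier R → x ≤[ R ] y → y ∈ Carrier xR
      ∈xR y∈R x≤y = y∈R , x≤y , proj₂ R.end-max y∈R

      xR-leaves-heads : ∀ {i y} → y ∈ Carrier R → x ≤[ R ] y → y ∈ Carrier (P i) → y ≤[ P i ] e i → x ≡ y
      xR-leaves-heads y∈R x≤y y∈P y≤e = ≤-antisym R x∈R y∈R x≤y (last y∈R y∈P y≤e)

      ends-only-x : ∀ {Q} → ABPathTo B″ Q x → ∀ {y} → y ∈ Carrier Q → y ∈ Carrier xH ∪ Carrier xR → x ≡ y
      ends-only-x Q-path y∈Q y∈ = ABPathTo.end-only Q-path y∈Q (inj₂ y∈)

      moved-≤ : ∀ i {y} → y ∈ Carrier (P i) → e i ≤[ P i ] y → e′ i ≤[ P i ] y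
      moved-≤ i y∈P e≤y = updateAt-elim (λ i z → ∀ {y} → y ∈ Carrier (P i) → e i ≤[ P i ] y → z ≤[ P i ] y)
        (λ y∈P → ≤-trans (P j) x∈Pj (e∈P j) y∈P x≤e) (λ _ _ _ e≤y → e≤y) i y∈P e≤y

      only-x : ∀ i {y} → x ≤[ P j ] y → y ∈ Carrier (P j) → y ∈ Carrier (P i) → e′ i ≤[ P i ] y
      only-x i x≤y y∈Pj y∈Pi with same y∈Pj y∈Pi
      ... | refl = subst (λ z → z ≤[ P j ] _) (sym (updateAt-updates j e)) x≤y

      -- A point of `xH` lies on `P j`, so `i` is `j`. A point of `xR` on `P i` is either beyond
      -- `e i` or on the head of `P i`, and then it is `x`.
      only′ : ∀ i {y} → y ∈ Carrier (P i) → y ∈ B″ → e′ i ≤[ P i ] y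
      only′ i y∈P (inj₁ y∈B′) = moved-≤ i y∈P (only i y∈P y∈B′)
      only′ i y∈P (inj₂ (inj₁ ((y∈Pj , _) , x≤y , _))) = only-x i x≤y y∈Pj y∈P
      only′ i y∈P (inj₂ (inj₂ (y∈R , x≤y , _))) with ≤-total (P i) (e∈P i) y∈P
      ... | inj₁ e≤y = moved-≤ i y∈P e≤y
      ... | inj₂ y≤e with xR-leaves-heads y∈R x≤y y∈P y≤e
      ...   | refl = only-x i (≤-refl (P j) x∈Pj) x∈Pj y∈P

      above-x : ∀ {y} → y ∈ Carrier (P j) → x ≤[ P j ] y → y ∈ B″
      above-x y∈P x≤y with ≤-total (P j) (e∈P j) y∈P
      ... | inj₁ e≤y = inj₁ (above j y∈P e≤y)
      ... | inj₂ y≤e = inj₂ (inj₁ (∈xH (∈head y∈P y≤e) x≤y))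

      -- `B″` arises from `B′` by adding two members of `𝒢`, on which compatibility provides first
      -- points.
      first′ : ∀ {R} → R ∈ IsABPath 𝒢 A B → HasLeast R B″
      first′ {S} S-path = HasLeast-∪ em₀ {S} (first S-path)
        (HasLeast-∪ em₀ {S}
          (first-on (proj₁ S-path) (segments H.∈𝒢 x∈H H.end∈ x≤e))
          (first-on (proj₁ S-path) (segments R.∈𝒢 x∈R R.end∈ (proj₂ R.end-max x∈R))))

      module _ (L : Linkage e′ B″) where

        open Linkage L

        Qj-path : ABPathTo B″ (Q j) x
        Qj-path = subst (ABPathTo B″ (Q j)) (updateAt-updates j e) (Q-path j)

        Qi-path : ∀ {i} → i ≢ j → ABPathTo B″ (Q i) (e i)
        Qi-path {i} i≢j = subst (ABPathTo B″ (Q i)) (updateAt-minimal i j e i≢j) (Q-path i)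

        t≢x : t ≢ x
        t≢x refl = disjoint₀ j (ABPathTo.end∈ Q₀-path , ABPathTo.end∈ Qj-path)

        -- `Q i` meets `B″` only in its end `e i`, which lies on `P i` and hence not on `P j`.
        Qi∌xH : ∀ {i} → i ≢ j → ∀ {y} → y ∈ Carrier (Q i) → y ∉ Carrier xH
        Qi∌xH {i} i≢j y∈Q y∈xH@((y∈Pj , _) , _) with ABPathTo.end-only (Qi-path i≢j) y∈Q (inj₂ (inj₁ y∈xH))
        ... | refl = i≢j (same (e∈P i) y∈Pj)

        -- The end `e i` lies on a head, so on `xR` it could only be `x`, a point of the other path
        -- `P j`.
        Qi∌xR : ∀ {i} → i ≢ j → ∀ {y} → y ∈ Carrier (Q i) → y ∉ Carrier xR
        Qi∌xR {i} i≢j y∈Q y∈xR@(y∈R , x≤y , _) with ABPathTo.end-only (Qi-path i≢j) y∈Q (inj₂ (inj₂ y∈xR))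
        ... | refl with xR-leaves-heads y∈R x≤y (e∈P i) (≤-refl (P i) (e∈P i))
        ...   | refl = i≢j (same (e∈P i) x∈Pj)

        Q₀-end : ∀ {y} → y ∈ Carrier Q₀ → y ∈ Carrier xH ∪ Carrier xR → t ≡ y
        Q₀-end y∈Q₀ y∈ = ABPathTo.end-only Q₀-path y∈Q₀ (inj₂ y∈)

        -- Only `Q₀` and `Q j` are replaced. Every other `Q i` ends in `e i`, a point of `B′`, and
        -- so is already a path to the smaller target.
        relink : ∀ {Z₀ Zj t′} → ABPathTo B′ Z₀ t′ → ABPathTo B′ Zj (e j) → Disjoint Z₀ Zj →
                 (∀ i → i ≢ j → Disjoint Z₀ (Q i)) → (∀ i → i ≢ j → Disjoint Zj (Q i)) →
                 Linkage e B′
        relink {Z₀} {Zj} Z₀-path Zj-path Z₀⊥Zj Z₀⊥Q Zj⊥Q = record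
          { Q         = Q′
          ; Q-path    = updateAt-elim (λ i Z → ABPathTo B′ Z (e i)) Zj-path
              (λ i i≢j → shrinkTarget inj₁ (above i (e∈P i) (≤-refl (P i) (e∈P i))) (Qi-path i≢j))
          ; disjoint  = λ {i} {k} → updateAt-elim (λ i Z → ∀ k → i ≢ k → Disjoint Z (Q′ k))
              (updateAt-elim (λ k Z → j ≢ k → Disjoint Zj Z)
                (contradiction refl) (λ k k≢j _ → Zj⊥Q k k≢j))
              (λ i i≢j → updateAt-elim (λ k Z → i ≢ k → Disjoint (Q i) Z)
                (λ _ (y∈Q , y∈Z) → Zj⊥Q i i≢j (y∈Z , y∈Q)) (λ _ _ → disjoint))
              i k
          ; Q₀        = Z₀
          ; t         = _
          ; Q₀-path   = Z₀-path
          ; disjoint₀ = updateAt-elim (λ _ → Disjoint Z₀) Z₀⊥Zj Z₀⊥Q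
          }
          where
          Q′ : Fin n → LinOrd U
          Q′ = updateAt Q j (const Zj)

        -- `Q₀` has reached the head of `P j` at `t`: it goes on along `H` to `e j` and takes over
        -- the role of `Q j`, while `Q j`, ending in `x`, goes on along `R` to `b` and becomes the
        -- additional path.
        swap : t ∈ Carrier xH → Linkage e B′
        swap (t∈H , x≤t , _)
          with extend inj₁ Q₀-path (head-path j) t∈H
                 (λ (y∈P , _) t≤y → above-x y∈P (≤-trans (P j) x∈Pj (proj₁ t∈H) y∈P x≤t t≤y))
             | extend inj₁ Qj-path R-path x∈R (λ y∈R x≤y → inj₂ (inj₂ (∈xR y∈R x≤y)))
        ... | Zj , Zj-path , Zj⊆ | Z₀ , Z₀-path , Z₀⊆ =
          relink Z₀-path Zj-path Z₀⊥Zj Z₀⊥Q Zj⊥Q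
          where
          tH⊆xH : ∀ {y} → y ∈ Carrier H → t ≤[ P j ] y → y ∈ Carrier xH
          tH⊆xH y∈H t≤y = ∈xH y∈H (≤-trans (P j) x∈Pj (proj₁ t∈H) (proj₁ y∈H) x≤t t≤y)

          x∉tH : ¬ (t ≤[ P j ] x)
          x∉tH t≤x = t≢x (≤-antisym (P j) (proj₁ t∈H) x∈Pj t≤x x≤t)

          Z₀⊥Zj : Disjoint Z₀ Zj
          Z₀⊥Zj (y∈Z₀ , y∈Zj) with Z₀⊆ y∈Z₀ | Zj⊆ y∈Zj
          ... | inj₁ y∈Qj | inj₁ y∈Q₀ = disjoint₀ j (y∈Q₀ , y∈Qj)
          ... | inj₁ y∈Qj | inj₂ (y∈H , t≤y) with ends-only-x Qj-path y∈Qj (inj₁ (tH⊆xH y∈H t≤y))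
          ...   | refl = x∉tH t≤y
          -- `Q₀` can meet `xR` only in `t`; as `t` lies on a head, it would be `x`.
          Z₀⊥Zj _ | inj₂ (y∈R , x≤y) | inj₁ y∈Q₀ with Q₀-end y∈Q₀ (inj₂ (∈xR y∈R x≤y))
          ...   | refl = t≢x (sym (xR-leaves-heads y∈R x≤y (proj₁ t∈H) (proj₂ (proj₂ t∈H))))
          Z₀⊥Zj _ | inj₂ (y∈R , x≤y) | inj₂ ((y∈P , _ , y≤e) , t≤y) with xR-leaves-heads y∈R x≤y y∈P y≤e
          ...   | refl = x∉tH t≤y

          Z₀⊥Q : ∀ i → i ≢ j → Disjoint Z₀ (Q i)
          Z₀⊥Q i i≢j (y∈Z₀ , y∈Q) with Z₀⊆ y∈Z₀
          ... | inj₁ y∈Qj        = disjoint i≢j (y∈Q , y∈Qj)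
          ... | inj₂ (y∈R , x≤y) = Qi∌xR i≢j y∈Q (∈xR y∈R x≤y)

          Zj⊥Q : ∀ i → i ≢ j → Disjoint Zj (Q i)
          Zj⊥Q i i≢j (y∈Zj , y∈Q) with Zj⊆ y∈Zj
          ... | inj₁ y∈Q₀        = disjoint₀ i (y∈Q₀ , y∈Q)
          ... | inj₂ (y∈H , t≤y) = Qi∌xH i≢j y∈Q (tH⊆xH y∈H t≤y)

        -- Off `xH`, the end `t` lies in `B′`, where `Q₀` is already complete, or on `xR`, along
        -- which it goes on to `b`. The added points differ from `x` because `t` comes strictly
        -- after `x` on `R`.
        continueQ₀ : t ∉ Carrier xH → Σ (LinOrd U) λ Z₀ → ∃ (ABPathTo B′ Z₀) ×
                     (∀ {y} → y ∈ Carrier Z₀ → y ∈ Carrier Q₀ ⊎ (y ∈ Carrier xR × x ≢ y))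
        continueQ₀ t∉xH with ABPathTo.end∈B Q₀-path
        ... | inj₁ t∈B′        = Q₀ , (t , shrinkTarget inj₁ t∈B′ Q₀-path) , inj₁
        ... | inj₂ (inj₁ t∈xH) = contradiction t∈xH t∉xH
        ... | inj₂ (inj₂ (t∈R , x≤t , _))
          with extend inj₁ Q₀-path R-path t∈R
                 (λ y∈R t≤y → inj₂ (inj₂ (∈xR y∈R (≤-trans R x∈R t∈R y∈R x≤t t≤y))))
        ...   | Z₀ , Z₀-path , Z₀⊆ = Z₀ , (b , Z₀-path) , λ y∈Z₀ → tail (Z₀⊆ y∈Z₀)
          where
          tail : ∀ {y} → y ∈ Carrier Q₀ ⊎ (y ∈ Carrier R × t ≤[ R ] y) →
                 y ∈ Carrier Q₀ ⊎ (y ∈ Carrier xR × x ≢ y)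
          tail (inj₁ y∈Q₀)        = inj₁ y∈Q₀
          tail (inj₂ (y∈R , t≤y)) =
            inj₂ (∈xR y∈R (≤-trans R x∈R t∈R y∈R x≤t t≤y) , λ { refl → t≢x (≤-antisym R t∈R x∈R t≤y x≤t) })

        -- `Q j` goes on from `x` along `H` to `e j`. The part of `xR` that `Q₀` may use omits `x`
        -- and therefore misses the heads.
        keep : t ∉ Carrier xH → Linkage e B′
        keep t∉xH
          with continueQ₀ t∉xH
             | extend inj₁ Qj-path (head-path j) x∈H (λ (y∈P , _) x≤y → above-x y∈P x≤y)
        ... | Z₀ , (_ , Z₀-path) , Z₀⊆ | Zj , Zj-path , Zj⊆ =
          relink Z₀-path Zj-path Z₀⊥Zj Z₀⊥Q Zj⊥Q
          where
          Z₀⊥Zj : Disjoint Z₀ Zj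
          Z₀⊥Zj (y∈Z₀ , y∈Zj) with Z₀⊆ y∈Z₀ | Zj⊆ y∈Zj
          ... | inj₁ y∈Q₀ | inj₁ y∈Qj = disjoint₀ j (y∈Q₀ , y∈Qj)
          ... | inj₁ y∈Q₀ | inj₂ (y∈H , x≤y) with Q₀-end y∈Q₀ (inj₁ (∈xH y∈H x≤y))
          ...   | refl = t∉xH (∈xH y∈H x≤y)
          Z₀⊥Zj _ | inj₂ (y∈xR , x≢y) | inj₁ y∈Qj = x≢y (ends-only-x Qj-path y∈Qj (inj₂ y∈xR))
          Z₀⊥Zj _ | inj₂ ((y∈R , x≤y , _) , x≢y) | inj₂ ((y∈P , _ , y≤e) , _) =
            x≢y (xR-leaves-heads y∈R x≤y y∈P y≤e)

          Z₀⊥Q : ∀ i → i ≢ j → Disjoint Z₀ (Q i)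
          Z₀⊥Q i i≢j (y∈Z₀ , y∈Q) with Z₀⊆ y∈Z₀
          ... | inj₁ y∈Q₀        = disjoint₀ i (y∈Q₀ , y∈Q)
          ... | inj₂ (y∈xR , _) = Qi∌xR i≢j y∈Q y∈xR

          Zj⊥Q : ∀ i → i ≢ j → Disjoint Zj (Q i)
          Zj⊥Q i i≢j (y∈Zj , y∈Q) with Zj⊆ y∈Zj
          ... | inj₁ y∈Qj        = disjoint i≢j (y∈Q , y∈Qj)
          ... | inj₂ (y∈H , x≤y) = Qi∌xH i≢j y∈Q (∈xH y∈H x≤y)

        reroute : Linkage e B′
        reroute with em₀ {t ∈ Carrier xH}
        ... | yes t∈xH = swap t∈xH
        ... | no  t∉xH = keep t∉xH

      nextStage : Stage e′ B″
      nextStage = record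
        { e∈P     = updateAt-elim (λ i z → z ∈ Carrier (P i)) x∈Pj (λ i _ → e∈P i)
        ; above   = updateAt-elim (λ i z → ∀ {y} → y ∈ Carrier (P i) → z ≤[ P i ] y → y ∈ B″)
                      above-x (λ i _ y∈P e≤y → inj₁ (above i y∈P e≤y))
        ; only    = only′
        ; first   = first′
        ; augment = augment ∘ reroute
        }

    -- Infima of the end points over all stages.

    Attained : Fin n → U → Set (suc ℓ)
    Attained i y = Σ (Fin n → U) λ e → Σ (Pred U ℓ) λ B′ → Stage e B′ × e i ≡ y

    -- Excluded middle brings Attained down to the level at which paths are complete.
    Attained₀ : Fin n → Pred U ℓ
    Attained₀ i y = Lift ℓ (True (em {Attained i y}))

    -- Completeness of `P i` applies because `initialStage` makes the set of attained points
    -- nonempty. The infimum itself need not be attained.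
    infimum : ∀ i → ∃ λ x → IsInfimum (P i) (Attained₀ i) x × x ∈ Carrier (P i)
    infimum i = proj₂ (paths (P.∈𝒢 i) (Attained₀ i)
      (λ (lift w) → attained∈P (toWitness w))
      (f i , lift (fromWitness (f , B , initialStage , refl))))
      where
      attained∈P : ∀ {y} → Attained i y → y ∈ Carrier (P i)
      attained∈P (e , B′ , s , refl) = Stage.e∈P s i

    x : Fin n → U
    x i = proj₁ (infimum i)

    x∈P : ∀ i → x i ∈ Carrier (P i)
    x∈P i = proj₂ (proj₂ (infimum i))

    x≤ : ∀ i {e B′} → Stage e B′ → x i ≤[ P i ] e i
    x≤ i s = proj₂ (proj₁ (proj₁ (proj₂ (infimum i)))) (lift (fromWitness (_ , _ , s , refl)))

    -- Otherwise `z` would be a lower bound of all attained points, hence below `x i`.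
    stage-below : ∀ {i z} → z ∈ Carrier (P i) → ¬ (z ≤[ P i ] x i) →
                  Σ (Fin n → U) λ e → Σ (Pred U ℓ) λ B′ → Stage e B′ × ¬ (z ≤[ P i ] e i)
    stage-below {i} {z} z∈P z≰x
      with em {Σ (Fin n → U) λ e → Σ (Pred U ℓ) λ B′ → Stage e B′ × ¬ (z ≤[ P i ] e i)}
    ... | yes found = found
    ... | no  none  = contradiction
      (proj₂ (proj₁ (proj₂ (infimum i))) (z∈P , λ (lift w) → bound (toWitness w))) z≰x
      where
      bound : ∀ {y} → Attained i y → z ≤[ P i ] y
      bound (e , B′ , s , refl) with em₀ {z ≤[ P i ] e i}
      ... | yes z≤e = z≤e
      ... | no  z≰e = contradiction (e , B′ , s , z≰e) none

    -- If the initial segment `S` of `R` avoids all heads, it forms a linkage with them. Otherwise a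
    -- step at the last point `z` of `S` on the heads moves some `e j` back to `z`; so `z` lies
    -- between `x j` and the old `e j`, which the hypothesis on `R` excludes.
    augment-along : ∀ {e B′} → Stage e B′ → ∀ {R} → R ∈ IsABPath 𝒢 A B → ∀ {b} → IsLeast R B′ b →
      (∀ {i y} → y ∈ Carrier R → y ≤[ R ] b → y ∈ Carrier (P i) → x i ≤[ P i ] y → ¬ (y ≤[ P i ] e i)) →
      DisjointABPaths B (ℕ.suc n)
    augment-along {e} {B′} s {R} R-AB {b} least avoids = finish em₀
      where
      open Stage s
      R-path : ∃ (ABPathTo B R)
      R-path = fromIsABPath R-AB

      S : LinOrd U
      S = segment R (ABPathTo.start (proj₂ R-path)) b

      S-path : ABPathTo B′ S b
      S-path = initialSegment (proj₂ R-path) least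

      heads : Pred U ℓ
      heads = ⋃ (Fin n) (Carrier ∘ head)

      finish : Dec (Satisfiable (Carrier S ∩ heads)) → DisjointABPaths B (ℕ.suc n)
      finish (no avoid) = augment record
        { Q         = head
        ; Q-path    = head-path
        ; disjoint  = λ i≢j ((y∈Pi , _) , (y∈Pj , _)) → P-disjoint i≢j (y∈Pi , y∈Pj)
        ; Q₀        = S
        ; t         = b
        ; Q₀-path   = S-path
        ; disjoint₀ = λ i (y∈S , y∈H) → avoid (_ , y∈S , i , y∈H)
        }
      finish (yes meet)
        with HasLeast-⋃ em₀ {dual S} {X = Carrier ∘ head}
               (λ i → last-on (ABPathTo.∈𝒢 S-path) (ABPathTo.∈𝒢 (head-path i))) meet
      ... | z , z∈S@(z∈R , _ , z≤b) , (j , z∈Pj , _ , z≤e) , last =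
        contradiction z≤e (avoids z∈R z≤b z∈Pj
          (subst (λ w → x j ≤[ P j ] w) (updateAt-updates j e) (x≤ j nextStage)))
        where
        open Step s S-path z∈S z∈Pj z≤e
               (λ y∈S y∈P y≤e → last y∈S (_ , ∈head y∈P y≤e))
               using (nextStage)

    -- A path avoiding all `x i` is followed to its first point on the tails; a stage in which some
    -- `e i` lies before that point then allows augmentation.
    augment-or-meet : ∀ R → R ∈ IsABPath 𝒢 A B → DisjointABPaths B (ℕ.suc n) ⊎ ∃ λ i → x i ∈ Carrier R
    augment-or-meet R R-AB with em₀ {∃ λ i → x i ∈ Carrier R}
    ... | yes meets = inj₂ meets
    ... | no  avoids = inj₁ (go em₀)
      where
      tail : Fin n → LinOrd U
      tail i = segment (P i) (x i) (f i)

      z∈B′ : ∀ {e B′ i z} (s : Stage e B′) → z ∈ Carrier (P i) → ¬ (z ≤[ P i ] e i) → z ∈ B′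
      z∈B′ {i = i} s z∈P z≰e with ≤-total (P i) (Stage.e∈P s i) z∈P
      ... | inj₁ e≤z = Stage.above s i z∈P e≤z
      ... | inj₂ z≤e = contradiction z≤e z≰e

      go : Dec (Satisfiable (Carrier R ∩ ⋃ (Fin n) (Carrier ∘ tail))) → DisjointABPaths B (ℕ.suc n)
      -- Without points on the tails, `R` has none between `x i` and `f i`, so the initial stage
      -- suffices.
      go (no none) =
        augment-along initialStage R-AB (end-least (proj₂ (fromIsABPath R-AB)))
          (λ y∈R _ y∈P x≤y _ → none (_ , y∈R , _ , y∈P , x≤y , proj₂ (P.end-max _) y∈P))
      go (yes meet)
        with HasLeast-⋃ em₀ {R} {X = Carrier ∘ tail}
               (λ i → first-on (proj₁ R-AB)
                        (segments (P.∈𝒢 i) (x∈P i) (P.end∈ i) (proj₂ (P.end-max i) (x∈P i)))) meet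
      ... | z , z∈R , (i , z∈P , x≤z , _) , z≤
        -- As `R` avoids `x i`, the point `z` lies strictly after it.
        with stage-below z∈P (λ z≤x → avoids (i , subst (Carrier R) (≤-antisym (P i) z∈P (x∈P i) z≤x x≤z) z∈R))
      ...   | e , B′ , s , z≰e
        with Stage.first s R-AB (z , z∈R , z∈B′ s z∈P z≰e)
      ...     | b , least@(b∈R , _ , b≤) = augment-along s R-AB least away
        where
        away : ∀ {k y} → y ∈ Carrier R → y ≤[ R ] b → y ∈ Carrier (P k) → x k ≤[ P k ] y → ¬ (y ≤[ P k ] e k)
        -- `z` lies in `B′`, so `y ≤ b ≤ z` on `R`; `y` lies on a tail, so `z ≤ y`. Hence `y` is
        -- `z`, which lies beyond `e i`.
        away {k} y∈R y≤b y∈P xk≤y y≤e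
          with ≤-antisym R y∈R z∈R (≤-trans R y∈R b∈R z∈R y≤b (b≤ z∈R (z∈B′ s z∈P z≰e)))
                 (z≤ y∈R (k , y∈P , xk≤y , proj₂ (P.end-max k) y∈P))
        ... | refl with same y∈P z∈P
        ...   | refl = z≰e y≤e

  -- Menger's theorem by induction on the number of paths.

  Separator : Pred U ℓ → ℕ → Set (suc ℓ)
  Separator B k = Σ (Pred U ℓ) λ X → X ⊆ V 𝒢 × (∃ λ n → n < k × HasCardinality _≡_ X n)
                    × (∀ R → R ∈ IsABPath 𝒢 A B → Meets X R)

  -- When disjoint paths from the previous case admit no larger family, their points `x i` separate,
  -- since a path missing all of them would yield one.
  menger : ∀ B k → Separator B k ⊎ DisjointABPaths B k
  menger B ℕ.zero = inj₂ ((λ ()) , (λ ()) , λ { {()} })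
  menger B (ℕ.suc k) with menger B k
  ... | inj₁ (X , X⊆V , (n , n<k , card) , sep) = inj₁ (X , X⊆V , (n , m<n⇒m<1+n n<k , card) , sep)
  ... | inj₂ (P , P-AB , P-disjoint) with em {DisjointABPaths B (ℕ.suc k)}
  ...   | yes paths = inj₂ paths
  ...   | no  ¬paths = inj₁
    ( (λ y → ∃ λ i → x i ≡ y)
    , (λ { (i , refl) → P i , proj₁ (P-AB i) , x∈P i })
    -- The `x i` are distinct because they lie on disjoint paths.
    , (k , n<1+n k , x , (λ {i} {j} xi≡xj → same (x∈P i) (subst (Carrier (P j)) (sym xi≡xj) (x∈P j)))
         , (λ y∈ → y∈) , (λ y∈ → y∈))
    , separates )
    where
    open Augmentation B P (proj₁ ∘ fromIsABPath ∘ P-AB) (proj₂ ∘ fromIsABPath ∘ P-AB) P-disjoint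
    separates : ∀ R → R ∈ IsABPath 𝒢 A B → Meets (λ y → ∃ λ i → x i ≡ y) R
    separates R R-AB with augment-or-meet R R-AB
    ... | inj₁ paths      = contradiction paths ¬paths
    ... | inj₂ (i , xi∈R) = x i , (i , refl) , xi∈R

  -- The set is the closure of the family under `≈`, in accordance with the identification of equal
  -- ordered sets.
  asSet : ∀ {B k} → DisjointABPaths B k →
    Σ (Pred (LinOrd U) ℓ) λ 𝒫 → HasCardinality _≈_ 𝒫 k × 𝒫 ⊆ IsABPath 𝒢 A B × PairwiseDisjoint 𝒫
  asSet {B} {k} (Q , Q-AB , Q-disjoint) =
      𝒫
    , (Q , injective , (λ P∈ → P∈) , (λ P∈ → P∈))
    , (λ {P} (i , Qi≈P) → IsABPath-respects-≈ {P = Q i} {P} Qi≈P (Q-AB i))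
    , (λ {P} {P′} → pairwiseDisjoint {P} {P′})
    where
    𝒫 : Pred (LinOrd U) ℓ
    𝒫 P = ∃ λ i → Q i ≈ P

    -- A path contains its start, so two disjoint members of the family cannot have the same
    -- carrier.
    injective : ∀ {i j} → Q i ≈ Q j → i ≡ j
    injective {i} {j} ((Qi⊆Qj , _) , _) with i ≟ j
    ... | yes i≡j = i≡j
    ... | no  i≢j = contradiction (start∈ , Qi⊆Qj start∈) (Q-disjoint i≢j)
      where
      open ABPathTo (proj₂ (fromIsABPath (Q-AB i))) using (start∈)

    pairwiseDisjoint : PairwiseDisjoint 𝒫
    pairwiseDisjoint {P} {P′} (i , Qi≈P@((_ , P⊆Qi) , _)) (j , Qj≈P′@((_ , P′⊆Qj) , _)) P≉P′ (y∈P , y∈P′)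
      with i ≟ j
    ... | yes refl = P≉P′ (≈-trans {P = P} {Q i} {P′} (≈-sym {P = Q i} {P} Qi≈P) Qj≈P′)
    ... | no  i≢j  = Q-disjoint i≢j (P⊆Qi y∈P , P′⊆Qj y∈P′)

mainTheorem8 : {ℓ : Level} → ExcludedMiddle (suc ℓ) →
    (U : Set ℓ) (𝒢 : Pred (LinOrd U) (suc ℓ)) → IsDipathSpace 𝒢 →
    (A B : Pred U ℓ) → A ⊆ V 𝒢 → B ⊆ V 𝒢 → (k : ℕ) →
    (Σ (Pred U ℓ) λ X → X ⊆ V 𝒢 × (∃ λ n → n < k × HasCardinality _≡_ X n) × (∀ R → R ∈ IsABPath 𝒢 A B → Meets X R))
    ⊎
    (Σ (Pred (LinOrd U) ℓ) λ 𝒫 → HasCardinality _≈_ 𝒫 k × 𝒫 ⊆ IsABPath 𝒢 A B × PairwiseDisjoint 𝒫)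
mainTheorem8 em U 𝒢 𝒢-space A B _ _ k with DipathSpace.menger em 𝒢-space A B k
... | inj₁ separator = inj₁ separator
... | inj₂ paths     = inj₂ (DipathSpace.asSet em 𝒢-space A paths)
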